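{- Let $d\ge 2$, let $q\equiv 1\pmod d$ be a prime power, let $S_d=\{x^d:x\in\mathbb{F}_q^*\}$, let $A'\subset\mathbb{F}_q^*$ and $\lambda\in\mathbb{F}_q^*$. If $ab+\lambda\in S_d\cup\{0\}$ for all $a,b\in A'$ with $a\ne b$, while there exist $a,b\in A'$ (not necessarily distinct) with $ab+\lambda\notin S_d\cup\{0\}$, then $|A'|\le\sqrt{2(q-1)/d}+4$. -}

module Defs where

open import Level using (0ℓ)
open import Data.Nat using (ℕ; zero; suc; _≤_)
import Data.Nat as ℕ
open import Data.Nat.Primality using (Prime)
open import Data.Fin using (Fin)
open import Data.Product using (∃; ∃-syntax; _×_)
open import Data.Sum using (_⊎_)
open import Relation.Nullary using (¬_)
open import Relation.Binary.PropositionalEquality using (_≡_; _≢_)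
open import Algebra.Structures using (IsCommutativeRing)
open import Function.Bundles using (_↔_)

IsPrimePower : ℕ → Set
IsPrimePower q = ∃[ p ] ∃[ k ] (Prime p × 1 ≤ k × q ≡ p ℕ.^ k)

record FiniteField (q : ℕ) : Set₁ where
  field
    F     : Set
    _+_   : F → F → F
    _*_   : F → F → F
    -_    : F → F
    0#    : F
    1#    : F
    isCommutativeRing : IsCommutativeRing _≡_ _+_ _*_ -_ 0# 1#
    0≢1   : 0# ≢ 1#
    inverse : ∀ x → x ≢ 0# → ∃[ y ] (x * y ≡ 1#)
    enum  : F ↔ Fin q

  infixl 6 _+_
  infixl 7 _*_
  infixr 8 _^_

  _^_ : F → ℕ → F
  x ^ zero  = 1#
  x ^ suc n = x * (x ^ n)

  _∈S[_] : F → ℕ → Set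
  y ∈S[ d ] = ∃[ x ] (x ≢ 0# × x ^ d ≡ y)

  _∈S[_]∪0 : F → ℕ → Set
  y ∈S[ d ]∪0 = y ∈S[ d ] ⊎ y ≡ 0#

{-# OPTIONS --safe #-}
module Submission where

-- Stepanov's method. The bad pair must be of the form (a₀, a₀). With m = (q − 1)/d, N = |A| and
-- N = s + e + 2, s < e, take f(x) = Σ c(a) (x − a)ˢ (λ′ + ax)ᵉ⁺ᵐ over a in A, where the weights
-- c(a) are those of the divided difference on A, which kills polynomials in a of degree at most
-- N − 2 = s + e. The condition on A says (λ′ + ab)ʲ⁺ᵐ = (λ′ + ab)ʲ for j > 0 and a ≠ b, while the
-- terms with a = b are shielded by the factor (x − a)ˢ. Hence modulo (x − b)ˢ the summand is a
-- polynomial in a of degree at most s + e, so f vanishes to order s at every b in A. The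
-- coefficient of (x − a₀)ˢ is c(a₀) (uᵉ⁺ᵐ − uᵉ) with u = λ′ + a₀², which is nonzero because u is not
-- a d-th power; so f ≠ 0 in any characteristic, and N s ≤ deg f ≤ s + e + m. Balancing s and e
-- gives the bound.

open import Defs
open import Algebra.Bundles using (CommutativeRing)
import Algebra.Properties.Ring
import Algebra.Solver.Ring.NaturalCoefficients.Default as NatSolver
import Data.Fin.Properties as Fin
open import Data.List using (List; []; _∷_; length; map; filter; deduplicate; foldr; allFin)
open import Data.List.Properties using (length-map; length-tabulate)
open import Data.List.Membership.Propositional using (_∈_; _∉_)
open import Data.List.Membership.Propositional.Properties
  using (∈-∃++; ∈-map⁺; ∈-map⁻; ∈-filter⁻; ∈-deduplicate⁺; ∈-deduplicate⁻; ∈-allFin; ∈-length)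
open import Data.List.Membership.Propositional.Properties.WithK using (unique∧set⇒bag)
open import Data.List.Relation.Binary.BagAndSetEquality using (∼bag⇒↭)
open import Data.List.Relation.Binary.Permutation.Propositional using (_↭_; ↭-sym; ↭⇒↭ₛ)
open import Data.List.Relation.Binary.Permutation.Propositional.Properties using (shift; ↭-length; ∈-resp-↭)
import Data.List.Relation.Binary.Permutation.Setoid.Properties as Permutationₛ
open import Data.List.Relation.Unary.Any using (here; there)
open import Data.List.Relation.Unary.All using (All; _∷_)
import Data.List.Relation.Unary.All as All
open import Data.List.Relation.Unary.AllPairs using (_∷_)
open import Data.List.Relation.Unary.Unique.Propositional using (Unique)
import Data.List.Relation.Unary.Unique.Propositional.Properties as Unique
open import Data.List.Relation.Unary.Unique.DecPropositional.Properties using (deduplicate-!)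
open import Data.Nat using (ℕ; zero; suc; _≤_; _<_; _∸_; z≤n; s≤s)
import Data.Nat as ℕ
import Data.Nat.Properties as ℕₚ
open import Data.Nat.Divisibility using (_∣_; divides)
open import Data.Nat.Tactic.RingSolver using (solve-∀)
open import Data.Product using (∃-syntax; _×_; _,_; proj₁; proj₂)
open import Data.Sum as Sum using (_⊎_; inj₁; inj₂)
open import Data.Vec using (Vec; []; _∷_)
import Data.Vec as Vec
open import Function using (_∘_; _$_)
open import Function.Bundles using (mk⇔; Inverse; Injection)
open import Function.Properties.Inverse using (↔⇒↣; ↔-sym)
open import Relation.Binary.Definitions using (DecidableEquality)
open import Relation.Binary.PropositionalEquality
open import Relation.Nullary using (¬_; Dec; yes; no; contradiction)
open import Relation.Nullary.Decidable using (via-injection; ¬?)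
open import Relation.Unary using (Decidable)
open ≡-Reasoning

-- Duplicate-free lists and counting by fibres

module _ {A : Set} where

  ∈-extract : {x : A} {xs : List A} → x ∈ xs → ∃[ ys ] xs ↭ x ∷ ys
  ∈-extract {x} x∈xs with as , bs , refl ← ∈-∃++ x∈xs = _ , shift x as bs

  Unique-resp-↭ : {xs ys : List A} → xs ↭ ys → Unique xs → Unique ys
  Unique-resp-↭ xs↭ys = Permutationₛ.Unique-resp-↭ (setoid A) (↭⇒↭ₛ xs↭ys)

  Unique⇒∉ : {x : A} {xs : List A} → Unique (x ∷ xs) → x ∉ xs
  Unique⇒∉ (x≢ ∷ _) x∈ = All.lookup x≢ x∈ refl

  length-filter-split : {P : A → Set} (P? : Decidable P) (xs : List A) →
    length xs ≡ length (filter P? xs) ℕ.+ length (filter (¬? ∘ P?) xs)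
  length-filter-split P? [] = refl
  length-filter-split P? (x ∷ xs) with P? x
  ... | yes _ = cong suc (length-filter-split P? xs)
  ... | no _  = trans (cong suc (length-filter-split P? xs)) (sym (ℕₚ.+-suc _ _))

  -- Each `y` splits its own fibre off `xs`. The fibre bound is asked of every duplicate-free list
  -- inside a fibre, the shape in which a bound on roots delivers it.
  length-fibres : {B : Set} (_≟_ : DecidableEquality B) (f : A → B) (n : ℕ) (ys : List B) (xs : List A) →
    Unique xs → (∀ {x} → x ∈ xs → f x ∈ ys) →
    (∀ {zs} y → y ∈ ys → Unique zs → (∀ {x} → x ∈ zs → f x ≡ y) → length zs ≤ n) →
    length xs ≤ length ys ℕ.* n
  length-fibres _≟_ f n [] [] _ _ _ = z≤n
  length-fibres _≟_ f n [] (x ∷ xs) _ img _ with () ← img (here refl)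
  length-fibres {B} _≟_ f n (y ∷ ys) xs u img fib =
    subst (_≤ n ℕ.+ length ys ℕ.* n) (sym (length-filter-split P? xs)) $ ℕₚ.+-mono-≤
      (fib y (here refl) (Unique.filter⁺ P? u) (proj₂ ∘ ∈-filter⁻ P? {xs = xs}))
      (length-fibres _≟_ f n ys _ (Unique.filter⁺ (¬? ∘ P?) u) img′ (λ z → fib z ∘ there))
    where
    P? : Decidable (λ x → f x ≡ y)
    P? x = f x ≟ y
    img′ : ∀ {x} → x ∈ filter (¬? ∘ P?) xs → f x ∈ ys
    img′ x∈ with x∈xs , fx≢y ← ∈-filter⁻ (¬? ∘ P?) {xs = xs} x∈ with img x∈xs
    ... | here fx≡y = contradiction fx≡y fx≢y
    ... | there fx∈ = fx∈

-- Field arithmetic: cancellation, powers, inverses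

module Field {q : ℕ} (K : FiniteField q) where
  open FiniteField K

  commutativeRing : CommutativeRing _ _
  commutativeRing = record { isCommutativeRing = isCommutativeRing }

  open CommutativeRing commutativeRing
    using (+-comm; +-assoc; *-comm; *-assoc; zeroˡ; zeroʳ; *-identityˡ; *-identityʳ;
           +-identityˡ; +-identityʳ; -‿inverseʳ; -‿inverseˡ; *-isCommutativeMonoid; ring; commutativeSemiring)
  open Algebra.Properties.Ring ring using (-1*x≈-x; +-cancelˡ)
  module S = NatSolver commutativeSemiring
  open S using (_:+_; _:*_; _:=_; con)

  _≟_ : DecidableEquality F
  _≟_ = via-injection (↔⇒↣ enum) Fin._≟_

  *≡0⇒ : ∀ {x y} → x ≢ 0# → x * y ≡ 0# → y ≡ 0#
  *≡0⇒ {x} {y} x≢0 xy≡0 with x⁻¹ , inv ← inverse x x≢0 = begin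
    y               ≡⟨ *-identityˡ y ⟨
    1# * y          ≡⟨ cong (_* y) inv ⟨
    x * x⁻¹ * y     ≡⟨ S.solve 3 (λ x z y → x :* z :* y := z :* (x :* y)) refl x x⁻¹ y ⟩
    x⁻¹ * (x * y)   ≡⟨ cong (x⁻¹ *_) xy≡0 ⟩
    x⁻¹ * 0#        ≡⟨ zeroʳ x⁻¹ ⟩
    0#              ∎

  *-≢0 : ∀ {x y} → x ≢ 0# → y ≢ 0# → x * y ≢ 0#
  *-≢0 x≢0 y≢0 = y≢0 ∘ *≡0⇒ x≢0

  *-cancelˡ : ∀ {x y z} → x ≢ 0# → x * y ≡ x * z → y ≡ z
  *-cancelˡ {x} {y} {z} x≢0 eq with x⁻¹ , inv ← inverse x x≢0 = trans (sym (undo y)) (trans (cong (x⁻¹ *_) eq) (undo z))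
    where
    undo : ∀ y → x⁻¹ * (x * y) ≡ y
    undo y = begin
      x⁻¹ * (x * y)   ≡⟨ S.solve 3 (λ x z y → z :* (x :* y) := x :* z :* y) refl x x⁻¹ y ⟩
      x * x⁻¹ * y     ≡⟨ cong (_* y) inv ⟩
      1# * y          ≡⟨ *-identityˡ y ⟩
      y               ∎

  ^-≢0 : ∀ {x} n → x ≢ 0# → x ^ n ≢ 0#
  ^-≢0 zero    x≢0 = 0≢1 ∘ sym
  ^-≢0 (suc n) x≢0 = *-≢0 x≢0 (^-≢0 n x≢0)

  ^-+ : ∀ x m n → x ^ (m ℕ.+ n) ≡ x ^ m * x ^ n
  ^-+ x zero    n = sym (*-identityˡ _)
  ^-+ x (suc m) n = trans (cong (x *_) (^-+ x m n)) (sym (*-assoc _ _ _))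

  ^-* : ∀ x m n → x ^ (m ℕ.* n) ≡ (x ^ n) ^ m
  ^-* x zero    n = refl
  ^-* x (suc m) n = trans (^-+ x n (m ℕ.* n)) (cong (x ^ n *_) (^-* x m n))

  diff≡0⇒≡ : ∀ a b → - a + b ≡ 0# → a ≡ b
  diff≡0⇒≡ a b eq = +-cancelˡ (- a) a b (trans (-‿inverseˡ a) (sym eq))

  -- inv 0# is junk (0#).
  inv : F → F
  inv x with x ≟ 0#
  ... | yes _   = 0#
  ... | no x≢0 = proj₁ (inverse x x≢0)

  inv-inverse : ∀ {x} → x ≢ 0# → x * inv x ≡ 1#
  inv-inverse {x} x≢0 with x ≟ 0#
  ... | yes x≡0 = contradiction x≡0 x≢0
  ... | no x≢0′ = proj₂ (inverse x x≢0′)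

  inv-≢0 : ∀ {x} → x ≢ 0# → inv x ≢ 0#
  inv-≢0 {x} x≢0 eq = 0≢1 (trans (sym (zeroʳ x)) (trans (cong (x *_) (sym eq)) (inv-inverse x≢0)))

  -- Taylor expansions of polynomials

  -- mulLin α β multiplies a power series by α + βt.
  mulLin : F → F → (ℕ → F) → ℕ → F
  mulLin α β g zero    = α * g zero
  mulLin α β g (suc k) = α * g (suc k) + β * g k

  mulLinPow : F → F → ℕ → (ℕ → F) → ℕ → F
  mulLinPow α β zero    g = g
  mulLinPow α β (suc n) g = mulLin α β (mulLinPow α β n g)

  -- Coefficient k of the product involves only coefficients up to k. This later lets an agreement
  -- in low orders pass through the factor (x - a)ˢ.
  mulLin-cong : ∀ α β {g h} k → (∀ {i} → i ≤ k → g i ≡ h i) → mulLin α β g k ≡ mulLin α β h k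
  mulLin-cong α β zero    eq = cong (α *_) (eq z≤n)
  mulLin-cong α β (suc k) eq = cong₂ (λ x y → α * x + β * y) (eq ℕₚ.≤-refl) (eq (ℕₚ.n≤1+n k))

  mulLinPow-cong : ∀ α β n {g h} k → (∀ {i} → i ≤ k → g i ≡ h i) →
                   mulLinPow α β n g k ≡ mulLinPow α β n h k
  mulLinPow-cong α β zero    k eq = eq ℕₚ.≤-refl
  mulLinPow-cong α β (suc n) k eq =
    mulLin-cong α β k λ i≤k → mulLinPow-cong α β n _ λ j≤i → eq (ℕₚ.≤-trans j≤i i≤k)

  -- A vector stands for the polynomial with these coefficients, constant term first.
  -- taylor b p k is the coefficient of (x − b)ᵏ in p, so taylor b p zero is p(b).
  taylor : ∀ {n} → F → Vec F n → ℕ → F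
  taylor b []      k       = 0#
  taylor b (c ∷ p) zero    = c + b * taylor b p zero
  taylor b (c ∷ p) (suc k) = b * taylor b p (suc k) + taylor b p k

  eval : ∀ {n} → Vec F n → F → F
  eval p a = taylor a p zero

  -- linc c α β p is c + (α + βx) p.
  linc : ∀ {n} → F → F → F → Vec F n → Vec F (suc n)
  linc c α β []      = c ∷ []
  linc c α β (x ∷ p) = (c + α * x) ∷ linc (β * x) α β p

  eval-linc : ∀ {n} c α β (p : Vec F n) b →
              eval (linc c α β p) b ≡ c + (α + β * b) * eval p b
  eval-linc c α β [] b = cong (c +_) (trans (zeroʳ b) (sym (zeroʳ _)))
  eval-linc c α β (x ∷ p) b = trans
    (cong (λ z → c + α * x + b * z) (eval-linc (β * x) α β p b))
    (S.solve 6 (λ c α β x b t → c :+ α :* x :+ b :* (β :* x :+ (α :+ β :* b) :* t)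
                  := c :+ (α :+ β :* b) :* (x :+ b :* t)) refl c α β x b (eval p b))

  -- Around b, α + βx is (α + βb) + β(x - b). The constant c enters coefficient 0 alone, so it is
  -- absent here.
  taylor-linc-suc : ∀ {n} c α β (p : Vec F n) b k →
    taylor b (linc c α β p) (suc k) ≡ mulLin (α + β * b) β (taylor b p) (suc k)
  taylor-linc-suc c α β [] b k =
    S.solve 3 (λ α β b → b :* con 0 :+ con 0 := (α :+ β :* b) :* con 0 :+ β :* con 0) refl α β b
  taylor-linc-suc c α β (x ∷ p) b zero = trans
    (cong₂ (λ y z → b * y + z) (taylor-linc-suc (β * x) α β p b zero) (eval-linc (β * x) α β p b))
    (S.solve 6 (λ α β b x t₀ t₁ →
        b :* ((α :+ β :* b) :* t₁ :+ β :* t₀) :+ (β :* x :+ (α :+ β :* b) :* t₀)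
        := (α :+ β :* b) :* (b :* t₁ :+ t₀) :+ β :* (x :+ b :* t₀))
      refl α β b x (taylor b p 0) (taylor b p 1))
  taylor-linc-suc c α β (x ∷ p) b (suc k) = trans
    (cong₂ (λ y z → b * y + z) (taylor-linc-suc (β * x) α β p b (suc k)) (taylor-linc-suc (β * x) α β p b k))
    (S.solve 6 (λ α β b t₀ t₁ t₂ →
        b :* ((α :+ β :* b) :* t₂ :+ β :* t₁) :+ ((α :+ β :* b) :* t₁ :+ β :* t₀)
        := (α :+ β :* b) :* (b :* t₂ :+ t₁) :+ β :* (b :* t₁ :+ t₀))
      refl α β b (taylor b p k) (taylor b p (suc k)) (taylor b p (suc (suc k))))

  taylor-lin : ∀ {n} α β (p : Vec F n) b k →
    taylor b (linc 0# α β p) k ≡ mulLin (α + β * b) β (taylor b p) k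
  taylor-lin α β p b zero    = trans (eval-linc 0# α β p b) (+-identityˡ _)
  taylor-lin α β p b (suc k) = taylor-linc-suc 0# α β p b k

  linPow : ∀ {n} → F → F → (j : ℕ) → Vec F n → Vec F (j ℕ.+ n)
  linPow α β zero    p = p
  linPow α β (suc j) p = linc 0# α β (linPow α β j p)

  taylor-linPow : ∀ {n} α β j (p : Vec F n) b k →
    taylor b (linPow α β j p) k ≡ mulLinPow (α + β * b) β j (taylor b p) k
  taylor-linPow α β zero    p b k = refl
  taylor-linPow α β (suc j) p b k = trans (taylor-lin α β (linPow α β j p) b k)
    (mulLin-cong _ β k λ _ → taylor-linPow α β j p b _)

  -- Counting roots with multiplicity

  -- Horner's scheme: the coefficients of the quotient are the values at b of the successive tails
  -- of `p`.
  divide : ∀ {n} b (p : Vec F (suc n)) → ∃[ q ] p ≡ linc (eval p b) (- b) 1# q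
  divide b (c ∷ []) = [] , cong (_∷ []) (sym (trans (cong (c +_) (zeroʳ b)) (+-identityʳ c)))
  divide b (c ∷ p@(_ ∷ _)) with q , eq ← divide b p = eval p b ∷ q , cong₂ _∷_
    (sym (begin
      c + b * r + - b * r      ≡⟨ S.solve 4 (λ c b r n → c :+ b :* r :+ n :* r := c :+ (b :+ n) :* r) refl c b r (- b) ⟩
      c + (b + - b) * r        ≡⟨ cong (λ z → c + z * r) (-‿inverseʳ b) ⟩
      c + 0# * r               ≡⟨ cong (c +_) (zeroˡ r) ⟩
      c + 0#                   ≡⟨ +-identityʳ c ⟩
      c                        ∎))
    (trans eq (cong (λ z → linc z (- b) 1# q) (sym (*-identityˡ r))))
    where r = eval p b

  -- The quotient is described by its Taylor coefficients at every point, since orders of vanishing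
  -- away from b have to be followed too.
  deflate : ∀ {n} b (p : Vec F (suc n)) → eval p b ≡ 0# →
    ∃[ q ] ∀ c k → taylor c p k ≡ mulLin (- b + 1# * c) 1# (taylor {n} c q) k
  deflate b p root with q , eq ← divide b p =
    q , λ c k → trans (cong (λ p → taylor c p k) (trans eq (cong (λ z → linc z (- b) 1# q) root)))
                      (taylor-lin (- b) 1# q c k)

  -- Taylor coefficients instead of derivatives: no factorial has to be inverted, so small
  -- characteristic does no harm.
  Vanishes : ∀ {n} → Vec F n → F → ℕ → Set
  Vanishes p b t = ∀ {k} → k < t → taylor b p k ≡ 0#

  Nonzero : ∀ {n} → Vec F n → Set
  Nonzero p = ∃[ b ] ∃[ k ] taylor b p k ≢ 0#

  -- For α ≠ 0 the factor α + βt is invertible as a power series, so the cofactor inherits low-order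
  -- vanishing.
  mulLin-cancel : ∀ {α} β {g} {t} → α ≢ 0# → (∀ {k} → k < t → mulLin α β g k ≡ 0#) →
                  ∀ {k} → k < t → g k ≡ 0#
  mulLin-cancel β α≢0 eq {zero}  k<t = *≡0⇒ α≢0 (eq k<t)
  mulLin-cancel {α} β {g} α≢0 eq {suc k} k<t = *≡0⇒ α≢0 (begin
    α * g (suc k)              ≡⟨ +-identityʳ _ ⟨
    α * g (suc k) + 0#         ≡⟨ cong (α * g (suc k) +_) (zeroʳ β) ⟨
    α * g (suc k) + β * 0#     ≡⟨ cong (λ z → α * g (suc k) + β * z)
                                   (mulLin-cancel β α≢0 eq (ℕₚ.<-trans (ℕₚ.n<1+n k) k<t)) ⟨
    α * g (suc k) + β * g k    ≡⟨ eq k<t ⟩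
    0#                         ∎)

  mulLin-shift : ∀ {α} g k → α ≡ 0# → mulLin α 1# g (suc k) ≡ g k
  mulLin-shift {α} g k refl =
    S.solve 2 (λ x y → con 0 :* x :+ con 1 :* y := y) refl (g (suc k)) (g k)

  -b+1*b : ∀ b → - b + 1# * b ≡ 0#
  -b+1*b b = trans (cong (- b +_) (*-identityˡ b)) (-‿inverseˡ b)

  mulLin-≢0 : ∀ α β {g} k → mulLin α β g k ≢ 0# → ∃[ i ] g i ≢ 0#
  mulLin-≢0 α β {g} zero neq = zero , λ eq → neq (trans (cong (α *_) eq) (zeroʳ α))
  mulLin-≢0 α β {g} (suc k) neq with g (suc k) ≟ 0#
  ... | no neq′ = suc k , neq′
  ... | yes eq = k , λ eq′ → neq (trans (cong₂ (λ x y → α * x + β * y) eq eq′)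
    (S.solve 2 (λ α β → α :* con 0 :+ β :* con 0 := con 0) refl α β))

  -- Each division by x - b removes one coefficient and one order of vanishing at b; orders at c ≠ b
  -- survive because the factor is nonzero there. A nonzero polynomial cannot run out of
  -- coefficients first, whence n = s + n′.
  deflatePow : ∀ {n} b s (p : Vec F n) → Nonzero p → Vanishes p b s →
    ∃[ n′ ] ∃[ r ] n ≡ s ℕ.+ n′ × Nonzero {n′} r ×
      (∀ {c t} → b ≢ c → Vanishes p c t → Vanishes r c t)
  deflatePow b zero    p p≢0 van = _ , p , refl , p≢0 , λ _ v → v
  deflatePow b (suc s) [] (_ , _ , neq) van = contradiction refl neq
  deflatePow b (suc s) p@(_ ∷ _) (c , k , neq) van
    with r , eq ← deflate b p (van (s≤s z≤n))
    with i , neq′ ← mulLin-≢0 _ 1# k (neq ∘ trans (eq c k))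
    with n′ , r′ , len , r′≢0 , pres ← deflatePow b s r (c , i , neq′)
           (λ {k} k<s → trans (sym (trans (eq b (suc k)) (mulLin-shift (taylor b r) k (-b+1*b b)))) (van (s≤s k<s)))
    = n′ , r′ , cong suc len , r′≢0 , λ {c} b≢c v → pres b≢c
        (mulLin-cancel 1# (λ z → b≢c (diff≡0⇒≡ b c (trans (cong (- b +_) (sym (*-identityˡ c))) z)))
          (λ {k} k<t → trans (sym (eq c k)) (v k<t)))

  -- The roots are divided out one after the other. As `n` counts coefficients, strictness amounts
  -- to a bound by the degree.
  roots-bound : ∀ {n} s bs → Unique bs → (p : Vec F n) → Nonzero p →
    (∀ {b} → b ∈ bs → Vanishes p b s) → length bs ℕ.* s < n
  roots-bound s [] _ [] (_ , _ , neq) van = contradiction refl neq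
  roots-bound s [] _ (_ ∷ _) p≢0 van = s≤s z≤n
  roots-bound s (b ∷ bs) (b∉ ∷ u) p p≢0 van
    with n′ , r , refl , r≢0 , pres ← deflatePow b s p p≢0 (van (here refl))
    = subst (_≤ s ℕ.+ n′) (ℕₚ.+-suc s _) (ℕₚ.+-monoʳ-≤ s
        (roots-bound s bs u r r≢0 λ c∈ → pres (All.lookup b∉ c∈) (van (there c∈))))

  -- Powers in the group of units

  eval-linPow : ∀ {n} α β j (p : Vec F n) b → eval (linPow α β j p) b ≡ (α + β * b) ^ j * eval p b
  eval-linPow α β zero    p b = sym (*-identityˡ _)
  eval-linPow α β (suc j) p b = begin
    eval (linPow α β (suc j) p) b                     ≡⟨ taylor-lin α β (linPow α β j p) b zero ⟩
    (α + β * b) * eval (linPow α β j p) b             ≡⟨ cong ((α + β * b) *_) (eval-linPow α β j p b) ⟩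
    (α + β * b) * ((α + β * b) ^ j * eval p b)        ≡⟨ *-assoc _ _ _ ⟨
    (α + β * b) ^ suc j * eval p b                    ∎

  -- Multiplicity one for xⁿ - c, which is nonzero because its value at 0 is -c.
  power-roots-bound : ∀ n c bs → 1 ≤ n → c ≢ 0# → Unique bs → (∀ {b} → b ∈ bs → b ^ n ≡ c) → length bs ≤ n
  power-roots-bound (suc n) c bs _ c≢0 u root = ℕₚ.≤-pred $
    subst₂ _<_ (ℕₚ.*-identityʳ _) (cong suc (ℕₚ.+-comm n 1)) $ roots-bound 1 bs u p nz van
    where
    p : Vec F (suc (n ℕ.+ 1))
    p = linc (- c) 0# 1# (linPow 0# 1# n (1# ∷ []))
    eval-p : ∀ b → eval p b ≡ - c + b ^ suc n
    eval-p b = begin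
      eval p b
        ≡⟨ trans (eval-linc (- c) 0# 1# (linPow 0# 1# n (1# ∷ [])) b)
                 (cong (λ z → - c + (0# + 1# * b) * z) (eval-linPow 0# 1# n (1# ∷ []) b)) ⟩
      - c + (0# + 1# * b) * ((0# + 1# * b) ^ n * (1# + b * 0#))
        ≡⟨ cong (λ z → - c + z * (z ^ n * (1# + b * 0#))) (S.solve 1 (λ b → con 0 :+ con 1 :* b := b) refl b) ⟩
      - c + b * (b ^ n * (1# + b * 0#))
        ≡⟨ cong (λ z → - c + b * z) (S.solve 2 (λ x b → x :* (con 1 :+ b :* con 0) := x) refl (b ^ n) b) ⟩
      - c + b ^ suc n ∎
    nz : Nonzero p
    nz = 0# , 0 , λ eq → c≢0 (trans (diff≡0⇒≡ c (0# ^ suc n) (trans (sym (eval-p 0#)) eq)) (zeroˡ _))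
    van : ∀ {b} → b ∈ bs → Vanishes p b 1
    van {b} b∈ {zero} _ = trans (eval-p b) (trans (cong (- c +_) (root b∈)) (-‿inverseˡ c))
    van b∈ {suc k} (s≤s ())

  elements : List F
  elements = map (Inverse.from enum) (allFin q)

  ∈-elements : ∀ x → x ∈ elements
  ∈-elements x = subst (_∈ elements) (Inverse.strictlyInverseʳ enum x)
    (∈-map⁺ (Inverse.from enum) (∈-allFin (Inverse.to enum x)))

  elements-unique : Unique elements
  elements-unique = Unique.map⁺ (Injection.injective (↔⇒↣ (↔-sym enum))) (Unique.allFin⁺ q)

  units : List F
  units = proj₁ (∈-extract (∈-elements 0#))

  elements↭ : elements ↭ 0# ∷ units
  elements↭ = proj₂ (∈-extract (∈-elements 0#))

  0∷units-unique : Unique (0# ∷ units)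
  0∷units-unique = Unique-resp-↭ elements↭ elements-unique

  units-unique : Unique units
  units-unique with _ ∷ u ← 0∷units-unique = u

  ∈-units⁺ : ∀ {x} → x ≢ 0# → x ∈ units
  ∈-units⁺ {x} x≢0 with ∈-resp-↭ elements↭ (∈-elements x)
  ... | here x≡0 = contradiction x≡0 x≢0
  ... | there x∈ = x∈

  ∈-units⁻ : ∀ {x} → x ∈ units → x ≢ 0#
  ∈-units⁻ x∈ refl = Unique⇒∉ 0∷units-unique x∈

  length-units : length units ≡ q ∸ 1
  length-units = cong (_∸ 1) (trans (sym (↭-length elements↭))
    (trans (length-map (Inverse.from enum) (allFin q)) (length-tabulate {n = q} _)))

  product : List F → F
  product = foldr _*_ 1#

  product-map-* : ∀ x xs → product (map (x *_) xs) ≡ x ^ length xs * product xs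
  product-map-* x []       = sym (*-identityˡ _)
  product-map-* x (y ∷ ys) = trans (cong (x * y *_) (product-map-* x ys))
    (S.solve 4 (λ x y p r → x :* y :* (p :* r) := x :* p :* (y :* r)) refl x y (x ^ length ys) (product ys))

  product-≢0 : ∀ xs → (∀ {x} → x ∈ xs → x ≢ 0#) → product xs ≢ 0#
  product-≢0 []       _   = 0≢1 ∘ sym
  product-≢0 (x ∷ xs) neq = *-≢0 (neq (here refl)) (product-≢0 xs (neq ∘ there))

  map-*-units : ∀ {x} → x ≢ 0# → map (x *_) units ↭ units
  map-*-units {x} x≢0 = ∼bag⇒↭ $ unique∧set⇒bag
    (Unique.map⁺ (*-cancelˡ x≢0) units-unique) units-unique (mk⇔ to from)
    where
    to : ∀ {y} → y ∈ map (x *_) units → y ∈ units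
    to y∈ with u , u∈ , refl ← ∈-map⁻ (x *_) y∈ = ∈-units⁺ (*-≢0 x≢0 (∈-units⁻ u∈))
    from : ∀ {y} → y ∈ units → y ∈ map (x *_) units
    from {y} y∈ = subst (_∈ map (x *_) units)
      (trans (sym (*-assoc _ _ _)) (trans (cong (_* y) (inv-inverse x≢0)) (*-identityˡ y)))
      (∈-map⁺ (x *_) (∈-units⁺ (*-≢0 (inv-≢0 x≢0) (∈-units⁻ y∈))))

  -- Multiplication by x permutes the units, so their product is unchanged when multiplied by x once
  -- per unit; this nonzero product cancels.
  fermat : ∀ {x} → x ≢ 0# → x ^ (q ∸ 1) ≡ 1#
  fermat {x} x≢0 = subst (λ n → x ^ n ≡ 1#) length-units $
    *-cancelˡ (product-≢0 units ∈-units⁻) $ begin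
      product units * x ^ length units     ≡⟨ *-comm _ _ ⟩
      x ^ length units * product units     ≡⟨ product-map-* x units ⟨
      product (map (x *_) units)           ≡⟨ Permutationₛ.foldr-commMonoid (setoid F)
                                                *-isCommutativeMonoid (↭⇒↭ₛ (map-*-units x≢0)) ⟩
      product units                        ≡⟨ *-identityʳ _ ⟨
      product units * 1#                   ∎

  module _ {d m : ℕ} (1≤d : 1 ≤ d) (q-1≡md : q ∸ 1 ≡ m ℕ.* d) where

    ∈S⇒^≡1 : ∀ {y} → y ∈S[ d ] → y ^ m ≡ 1#
    ∈S⇒^≡1 (x , x≢0 , refl) =
      trans (sym (^-* x m d)) (trans (cong (x ^_) (sym q-1≡md)) (fermat x≢0))

    -- Otherwise q - 1 = 0 and there would be no units, but `1#` is one.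
    1≤m : 1 ≤ m
    1≤m = ℕₚ.n≢0⇒n>0 λ m≡0 → ℕₚ.<-irrefl (sym (trans q-1≡md (cong (ℕ._* d) m≡0)))
      (subst (0 <_) length-units (∈-length (∈-units⁺ (0≢1 ∘ sym))))

    -- Otherwise at most m − 1 values would be d-th powers of units, each with at most d roots.
    ^≡1⇒∈S : ∀ {y} → y ^ m ≡ 1# → ¬ ¬ y ∈S[ d ]
    ^≡1⇒∈S {y} y^m≡1 y∉S = ℕₚ.<-irrefl refl $ ℕₚ.<-≤-trans
      (ℕₚ.*-monoˡ-< d {{ℕ.>-nonZero 1≤d}} images<m)
      (subst (_≤ length images ℕ.* d) (trans length-units q-1≡md)
        (length-fibres _≟_ (_^ d) d images units units-unique
          (λ x∈ → ∈-deduplicate⁺ _≟_ (∈-map⁺ (_^ d) x∈))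
          λ z z∈ u → power-roots-bound d z _ 1≤d (image-≢0 z∈) u))
      where
      images : List F
      images = deduplicate _≟_ (map (_^ d) units)
      image-∈S : ∀ {z} → z ∈ images → z ∈S[ d ]
      image-∈S z∈ with x , x∈ , refl ← ∈-map⁻ (_^ d) (∈-deduplicate⁻ _≟_ (map (_^ d) units) z∈) =
        x , ∈-units⁻ x∈ , refl
      image-≢0 : ∀ {z} → z ∈ images → z ≢ 0#
      image-≢0 z∈ with _ , x≢0 , refl ← image-∈S z∈ = ^-≢0 d x≢0
      root : ∀ {z} → z ∈ y ∷ images → z ^ m ≡ 1#
      root (here refl) = y^m≡1
      root (there z∈)  = ∈S⇒^≡1 (image-∈S z∈)
      -- `y` is one more root of zᵐ = 1 outside `images`, which makes the inequality strict.
      images<m : length images < m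
      images<m = power-roots-bound m 1# (y ∷ images) 1≤m (0≢1 ∘ sym)
        (All.tabulate (λ z∈ y≡z → y∉S (subst _∈S[ d ] (sym y≡z) (image-∈S z∈))) ∷ deduplicate-! _≟_ _)
        root

  -- Polynomial functions and divided differences

  taylor-+ : ∀ {n} (p r : Vec F n) b k → taylor b (Vec.zipWith _+_ p r) k ≡ taylor b p k + taylor b r k
  taylor-+ []      []      b k    = sym (+-identityʳ 0#)
  taylor-+ (x ∷ p) (y ∷ r) b zero = trans (cong (λ z → x + y + b * z) (taylor-+ p r b zero))
    (S.solve 5 (λ x y b s t → x :+ y :+ b :* (s :+ t) := x :+ b :* s :+ (y :+ b :* t)) refl
      x y b (eval p b) (eval r b))
  taylor-+ (x ∷ p) (y ∷ r) b (suc k) =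
    trans (cong₂ (λ z w → b * z + w) (taylor-+ p r b (suc k)) (taylor-+ p r b k))
    (S.solve 5 (λ b s t v w → b :* (s :+ t) :+ (v :+ w) := b :* s :+ v :+ (b :* t :+ w)) refl
      b (taylor b p (suc k)) (taylor b r (suc k)) (taylor b p k) (taylor b r k))

  taylor-* : ∀ {n} c (p : Vec F n) b k → taylor b (Vec.map (c *_) p) k ≡ c * taylor b p k
  taylor-* c []      b k    = sym (zeroʳ c)
  taylor-* c (x ∷ p) b zero = trans (cong (λ z → c * x + b * z) (taylor-* c p b zero))
    (S.solve 4 (λ c x b t → c :* x :+ b :* (c :* t) := c :* (x :+ b :* t)) refl c x b (eval p b))
  taylor-* c (x ∷ p) b (suc k) =
    trans (cong₂ (λ z w → b * z + w) (taylor-* c p b (suc k)) (taylor-* c p b k))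
    (S.solve 4 (λ c b s t → b :* (c :* s) :+ c :* t := c :* (b :* s :+ t)) refl
      c b (taylor b p (suc k)) (taylor b p k))

  taylor-0 : ∀ n b k → taylor b (Vec.replicate n 0#) k ≡ 0#
  taylor-0 zero    b k       = refl
  taylor-0 (suc n) b zero    = trans (cong (λ z → 0# + b * z) (taylor-0 n b zero))
    (S.solve 1 (λ b → con 0 :+ b :* con 0 := con 0) refl b)
  taylor-0 (suc n) b (suc k) = trans (cong₂ (λ z w → b * z + w) (taylor-0 n b (suc k)) (taylor-0 n b k))
    (S.solve 1 (λ b → b :* con 0 :+ con 0 := con 0) refl b)

  -- n bounds the number of coefficients, i.e. the degree is less than n.
  PolyFn : ℕ → (F → F) → Set
  PolyFn n φ = ∃[ p ] (∀ a → φ a ≡ eval {n} p a)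

  polyFn-cong : ∀ {n φ ψ} → (∀ a → φ a ≡ ψ a) → PolyFn n φ → PolyFn n ψ
  polyFn-cong eq (p , φ≡) = p , λ a → trans (sym (eq a)) (φ≡ a)

  polyFn-1 : PolyFn 1 (λ _ → 1#)
  polyFn-1 = 1# ∷ [] , λ a → S.solve 1 (λ a → con 1 := con 1 :+ a :* con 0) refl a

  polyFn-+ : ∀ {n φ ψ} → PolyFn n φ → PolyFn n ψ → PolyFn n (λ a → φ a + ψ a)
  polyFn-+ (p , φ≡) (r , ψ≡) = Vec.zipWith _+_ p r ,
    λ a → trans (cong₂ _+_ (φ≡ a) (ψ≡ a)) (sym (taylor-+ p r a zero))

  polyFn-* : ∀ {n φ} c → PolyFn n φ → PolyFn n (λ a → c * φ a)
  polyFn-* c (p , φ≡) = Vec.map (c *_) p , λ a → trans (cong (c *_) (φ≡ a)) (sym (taylor-* c p a zero))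

  polyFn-linPow : ∀ {n φ} α β j → PolyFn n φ → PolyFn (j ℕ.+ n) (λ a → (α + β * a) ^ j * φ a)
  polyFn-linPow α β j (p , φ≡) = linPow α β j p ,
    λ a → trans (cong ((α + β * a) ^ j *_) (φ≡ a)) (sym (eval-linPow α β j p a))

  polyFn-lin : ∀ {n φ} α β → PolyFn n φ → PolyFn (suc n) (λ a → (α + β * a) * φ a)
  polyFn-lin α β pφ = polyFn-cong (λ a → cong (_* _) (*-identityʳ _)) (polyFn-linPow α β 1 pφ)

  polyFn-weaken : ∀ {n φ} → PolyFn n φ → PolyFn (suc n) φ
  polyFn-weaken {φ = φ} pφ = polyFn-cong
    (λ a → S.solve 2 (λ a x → (con 1 :+ con 0 :* a) :* x := x) refl a (φ a)) (polyFn-lin 1# 0# pφ)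

  -- Here a, not x, is the variable. At b the factor x - a reads (b - a) + (x - b), so each of the s
  -- factors raises the degree in a by at most one.
  polyFn-mulLinPow : ∀ {n e} b s {Φ : F → ℕ → F} → (∀ {k} → k < e → PolyFn n (λ a → Φ a k)) →
    ∀ {k} → k < e → PolyFn (s ℕ.+ n) (λ a → mulLinPow (- a + 1# * b) 1# s (Φ a) k)
  polyFn-mulLinPow b zero    pΦ k<e = pΦ k<e
  polyFn-mulLinPow b (suc s) {Φ} pΦ {k} k<e = go k k<e
    where
    G : F → ℕ → F
    G a = mulLinPow (- a + 1# * b) 1# s (Φ a)
    pG = polyFn-mulLinPow b s {Φ} pΦ
    linear : ∀ a → b + - 1# * a ≡ - a + 1# * b
    linear a = trans (+-comm _ _) (cong₂ _+_ (-1*x≈-x a) (sym (*-identityˡ b)))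
    top : ∀ {k} → k < _ → PolyFn _ (λ a → (- a + 1# * b) * G a k)
    top k<e = polyFn-cong (λ a → cong (_* G a _) (linear a)) (polyFn-lin b (- 1#) (pG k<e))
    go : ∀ k → k < _ → PolyFn _ (λ a → mulLin (- a + 1# * b) 1# (G a) k)
    go zero    k<e = top k<e
    go (suc k) k<e = polyFn-+ (top k<e) (polyFn-* 1# (polyFn-weaken (pG (ℕₚ.<-trans (ℕₚ.n<1+n k) k<e))))

  -- A list of (weight, point) pairs stands for the functional φ ↦ Σ w φ(a).
  wsum : List (F × F) → (F → F) → F
  wsum []            φ = 0#
  wsum ((w , a) ∷ W) φ = w * φ a + wsum W φ

  reweight : (F → F) → List (F × F) → List (F × F)
  reweight g = map λ (w , a) → w * g a , a

  wsum-reweight : ∀ g W φ → wsum (reweight g W) φ ≡ wsum W (λ a → g a * φ a)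
  wsum-reweight g []            φ = refl
  wsum-reweight g ((w , a) ∷ W) φ = cong₂ _+_ (*-assoc _ _ _) (wsum-reweight g W φ)

  wsum-+ : ∀ W φ ψ → wsum W (λ a → φ a + ψ a) ≡ wsum W φ + wsum W ψ
  wsum-+ []            φ ψ = sym (+-identityʳ 0#)
  wsum-+ ((w , a) ∷ W) φ ψ = trans (cong (w * (φ a + ψ a) +_) (wsum-+ W φ ψ))
    (S.solve 5 (λ w x y s t → w :* (x :+ y) :+ (s :+ t) := w :* x :+ s :+ (w :* y :+ t)) refl
      w (φ a) (ψ a) (wsum W φ) (wsum W ψ))

  wsum-*ʳ : ∀ W φ c → wsum W (λ a → φ a * c) ≡ wsum W φ * c
  wsum-*ʳ []            φ c = sym (zeroˡ c)
  wsum-*ʳ ((w , a) ∷ W) φ c = trans (cong (w * (φ a * c) +_) (wsum-*ʳ W φ c))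
    (S.solve 4 (λ w x s c → w :* (x :* c) :+ s :* c := (w :* x :+ s) :* c) refl w (φ a) (wsum W φ) c)

  combine : ∀ {n} → List (F × F) → (F → Vec F n) → Vec F n
  combine {n} []        t = Vec.replicate n 0#
  combine ((w , a) ∷ W) t = Vec.zipWith _+_ (Vec.map (w *_) (t a)) (combine W t)

  taylor-combine : ∀ {n} W (t : F → Vec F n) b k → taylor b (combine W t) k ≡ wsum W (λ a → taylor b (t a) k)
  taylor-combine {n} []        t b k = taylor-0 n b k
  taylor-combine ((w , a) ∷ W) t b k = trans (taylor-+ (Vec.map (w *_) (t a)) _ b k)
    (cong₂ _+_ (taylor-* w (t a) b k) (taylor-combine W t b k))

  -- The weight `leading` at `a₀` is kept apart because f ≠ 0 is read off at `a₀`. The construction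
  -- below makes it the product of 1/(a₀ - z) over `zs`.
  record DividedDifference (a₀ : F) (zs : List F) : Set where
    field
      weights     : List (F × F)
      wsum-cong   : ∀ {φ ψ} → (∀ {a} → a ∈ a₀ ∷ zs → φ a ≡ ψ a) → wsum weights φ ≡ wsum weights ψ
      annihilates : ∀ {φ} → PolyFn (length zs) φ → wsum weights φ ≡ 0#
      leading     : F
      leading≢0   : leading ≢ 0#
      wsum-single : ∀ φ → (∀ {a} → a ∈ zs → φ a ≡ 0#) → wsum weights φ ≡ leading * φ a₀

  -- The recursion φ[z, zs, a₀] = ψ[zs, a₀] for ψ(a) = (φ(a) − φ(z)) / (a − z).
  dividedDifference : ∀ a₀ zs → Unique (a₀ ∷ zs) → DividedDifference a₀ zs
  dividedDifference a₀ [] _ = record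
    { weights     = (1# , a₀) ∷ []
    ; wsum-cong   = λ eq → cong (λ x → 1# * x + 0#) (eq (here refl))
    ; annihilates = λ { ([] , φ≡) → trans (cong (λ x → 1# * x + 0#) (φ≡ a₀))
                                      (S.solve 0 (con 1 :* con 0 :+ con 0 := con 0) refl) }
    ; leading     = 1#
    ; leading≢0   = 0≢1 ∘ sym
    ; wsum-single = λ φ _ → +-identityʳ _
    }
  dividedDifference a₀ (z ∷ zs) ((a₀≢z ∷ a₀≢) ∷ z≢ ∷ u) = record
    -- Dividing φ(a) - φ(z) by a - z leaves -Σ w/(a - z) as the weight of φ(z).
    { weights     = (- wsum W g , z) ∷ reweight g W
    ; wsum-cong   = λ {φ} {ψ} eq → cong₂ (λ x y → - wsum W g * x + y) (eq (there (here refl)))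
        (trans (wsum-reweight g W φ)
          (trans (DD.wsum-cong (λ {a} a∈ → cong (g a *_) (eq (weaken∈ a∈)))) (sym (wsum-reweight g W ψ))))
    ; annihilates = annihilates
    ; leading     = DD.leading * g a₀
    ; leading≢0   = *-≢0 DD.leading≢0 (inv-≢0 (diff≢0 (here refl)))
    ; wsum-single = λ φ φ≡0 → begin
        - wsum W g * φ z + wsum (reweight g W) φ
          ≡⟨ cong₂ _+_ (trans (cong (- wsum W g *_) (φ≡0 (here refl))) (zeroʳ _)) (wsum-reweight g W φ) ⟩
        0# + wsum W (λ a → g a * φ a)
          ≡⟨ +-identityˡ _ ⟩
        wsum W (λ a → g a * φ a)
          ≡⟨ DD.wsum-single _ (λ {a} a∈ → trans (cong (g a *_) (φ≡0 (there a∈))) (zeroʳ _)) ⟩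
        DD.leading * (g a₀ * φ a₀)
          ≡⟨ *-assoc _ _ _ ⟨
        DD.leading * g a₀ * φ a₀ ∎
    }
    where
    module DD = DividedDifference (dividedDifference a₀ zs (a₀≢ ∷ u))
    W = DD.weights
    g : F → F
    g a = inv (- z + 1# * a)
    weaken∈ : ∀ {a} → a ∈ a₀ ∷ zs → a ∈ a₀ ∷ z ∷ zs
    weaken∈ (here eq)  = here eq
    weaken∈ (there a∈) = there (there a∈)
    z≢point : ∀ {a} → a ∈ a₀ ∷ zs → z ≢ a
    z≢point (here refl) = a₀≢z ∘ sym
    z≢point (there a∈)  = All.lookup z≢ a∈
    diff≢0 : ∀ {a} → a ∈ a₀ ∷ zs → - z + 1# * a ≢ 0#
    diff≢0 {a} a∈ eq = z≢point a∈ (diff≡0⇒≡ z a (trans (cong (- z +_) (sym (*-identityˡ a))) eq))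
    annihilates : ∀ {φ} → PolyFn (suc (length zs)) φ → - wsum W g * φ z + wsum (reweight g W) φ ≡ 0#
    -- With φ(a) = φ(z) + (a - z) r(a), the φ(z) terms cancel against the weight at `z`, and r has
    -- one coefficient fewer, so the functional on `a₀ ∷ zs` kills it.
    annihilates {φ} (p , φ≡) with r , p≡ ← divide z p = begin
      - wsum W g * φ z + wsum (reweight g W) φ
        ≡⟨ cong (- wsum W g * φ z +_) (trans (wsum-reweight g W φ) (DD.wsum-cong quotient)) ⟩
      - wsum W g * φ z + wsum W (λ a → g a * φ z + eval r a)
        ≡⟨ cong (- wsum W g * φ z +_) (trans (wsum-+ W _ _)
             (cong₂ _+_ (wsum-*ʳ W g (φ z)) (DD.annihilates (r , λ _ → refl)))) ⟩
      - wsum W g * φ z + (wsum W g * φ z + 0#)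
        ≡⟨ S.solve 3 (λ n s x → n :* x :+ (s :* x :+ con 0) := (n :+ s) :* x) refl (- wsum W g) (wsum W g) (φ z) ⟩
      (- wsum W g + wsum W g) * φ z
        ≡⟨ cong (_* φ z) (-‿inverseˡ _) ⟩
      0# * φ z
        ≡⟨ zeroˡ _ ⟩
      0# ∎
      where
      quotient : ∀ {a} → a ∈ a₀ ∷ zs → g a * φ a ≡ g a * φ z + eval r a
      quotient {a} a∈ = begin
        g a * φ a
          ≡⟨ cong (g a *_) (trans (φ≡ a) (trans (cong (λ p → eval p a) p≡)
               (trans (eval-linc (eval p z) (- z) 1# r a) (cong (_+ _) (sym (φ≡ z)))))) ⟩
        g a * (φ z + (- z + 1# * a) * eval r a)
          ≡⟨ S.solve 4 (λ g x y t → g :* (x :+ y :* t) := g :* x :+ y :* g :* t) refl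
               (g a) (φ z) (- z + 1# * a) (eval r a) ⟩
        g a * φ z + (- z + 1# * a) * g a * eval r a
          ≡⟨ cong (λ x → g a * φ z + x * eval r a) (inv-inverse (diff≢0 a∈)) ⟩
        g a * φ z + 1# * eval r a
          ≡⟨ cong (g a * φ z +_) (*-identityˡ _) ⟩
        g a * φ z + eval r a ∎

  -- Stepanov's method

  δ : ℕ → F
  δ zero    = 1#
  δ (suc _) = 0#

  taylor-1 : ∀ b k → taylor b (1# ∷ []) k ≡ δ k
  taylor-1 b zero    = S.solve 1 (λ b → con 1 :+ b :* con 0 := con 1) refl b
  taylor-1 b (suc k) = S.solve 1 (λ b → b :* con 0 :+ con 0 := con 0) refl b

  -- The image in F of the binomial coefficient C(j + k, k).
  binom : ℕ → ℕ → F
  binom j       zero    = 1#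
  binom zero    (suc k) = binom zero k
  binom (suc j) (suc k) = binom j (suc k) + binom (suc j) k

  mulLinPow-at-0 : ∀ α β n g → mulLinPow α β n g zero ≡ α ^ n * g zero
  mulLinPow-at-0 α β zero    g = sym (*-identityˡ _)
  mulLinPow-at-0 α β (suc n) g = trans (cong (α *_) (mulLinPow-at-0 α β n g)) (sym (*-assoc _ _ _))

  mulLinPow-δ-high : ∀ α β n {k} → n < k → mulLinPow α β n δ k ≡ 0#
  mulLinPow-δ-high α β zero    {suc k} _         = refl
  mulLinPow-δ-high α β (suc n) {suc k} (s≤s n<k) = trans
    (cong₂ (λ x y → α * x + β * y) (mulLinPow-δ-high α β n (ℕₚ.m<n⇒m<1+n n<k)) (mulLinPow-δ-high α β n n<k))
    (S.solve 2 (λ α β → α :* con 0 :+ β :* con 0 := con 0) refl α β)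

  -- The binomial theorem, with the exponent written as j + k so that no truncated subtraction
  -- occurs and Pascal's rule fits the recursion.
  mulLinPow-δ : ∀ α β j k → mulLinPow α β (j ℕ.+ k) δ k ≡ binom j k * (β ^ k * α ^ j)
  mulLinPow-δ α β j zero rewrite ℕₚ.+-identityʳ j = trans (mulLinPow-at-0 α β j δ)
    (S.solve 1 (λ x → x :* con 1 := con 1 :* (con 1 :* x)) refl (α ^ j))
  mulLinPow-δ α β zero (suc k) = trans
    (cong₂ (λ x y → α * x + β * y) (mulLinPow-δ-high α β k (ℕₚ.n<1+n k)) (mulLinPow-δ α β zero k))
    (S.solve 4 (λ α β c x → α :* con 0 :+ β :* (c :* (x :* con 1)) := c :* (β :* x :* con 1)) refl
      α β (binom zero k) (β ^ k))
  mulLinPow-δ α β (suc j) (suc k) = trans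
    (cong₂ (λ x y → α * x + β * y)
      (mulLinPow-δ α β j (suc k))
      (trans (cong (λ n → mulLinPow α β n δ k) (ℕₚ.+-suc j k)) (mulLinPow-δ α β (suc j) k)))
    (S.solve 6 (λ α β c d x y → α :* (c :* (β :* x :* y)) :+ β :* (d :* (x :* (α :* y)))
                  := (c :+ d) :* (β :* x :* (α :* y))) refl
      α β (binom j (suc k)) (binom (suc j) k) (β ^ k) (α ^ j))

  -- At its root the linear factor is t, so its s-th power shifts coefficients by s. This is what
  -- shields the terms with a = b.
  mulLinPow-root-low : ∀ {α} s g {k} → α ≡ 0# → k < s → mulLinPow α 1# s g k ≡ 0#
  mulLinPow-root-low (suc s) g {zero}  refl _         = zeroˡ _
  mulLinPow-root-low (suc s) g {suc k} α≡0  (s≤s k<s) =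
    trans (mulLin-shift (mulLinPow _ 1# s g) k α≡0) (mulLinPow-root-low s g α≡0 k<s)

  mulLinPow-root : ∀ {α} s g → α ≡ 0# → mulLinPow α 1# s g s ≡ g zero
  mulLinPow-root zero    g α≡0 = refl
  mulLinPow-root (suc s) g α≡0 = trans (mulLin-shift (mulLinPow _ 1# s g) s α≡0) (mulLinPow-root s g α≡0)

  RootOrZero : ℕ → F → Set
  RootOrZero m u = u ^ m ≡ 1# ⊎ u ≡ 0#

  -- The exponent is kept positive for the sake of u = 0, where 0⁰ = 1 but every positive power is
  -- 0.
  rootOrZero-^ : ∀ {m u} j → RootOrZero m u → u ^ (suc j ℕ.+ m) ≡ u ^ suc j
  rootOrZero-^ {m} {u} j (inj₁ eq)   = trans (^-+ u (suc j) m) (trans (cong (u ^ suc j *_) eq) (*-identityʳ _))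
  rootOrZero-^         j (inj₂ refl) = trans (zeroˡ _) (sym (zeroˡ _))

  -- By s < e the exponents e - k stay positive for all k ≤ s. The case k = s matters because the
  -- coefficient of (x - a₀)ˢ is compared too.
  module Stepanov (μ : F) (m e s : ℕ) (s<e : s < e) where

    -- The Taylor coefficients at b of (x − a)ˢ (μ + ax)ᵉ⁺ᵐ.
    actual : F → F → ℕ → F
    actual b a = mulLinPow (- a + 1# * b) 1# s (mulLinPow (μ + a * b) a (e ℕ.+ m) δ)

    -- What actual becomes when powers (μ + ab)ʲ⁺ᵐ with j > 0 are replaced by (μ + ab)ʲ:
    -- as a function of a it is then a polynomial of degree at most s + e.
    reducedFactor : F → F → ℕ → F
    reducedFactor b a k = binom ((e ∸ k) ℕ.+ m) k * (a ^ k * (μ + a * b) ^ (e ∸ k))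

    reduced : F → F → ℕ → F
    reduced b a = mulLinPow (- a + 1# * b) 1# s (reducedFactor b a)

    -- Degrees in a add up: k from aᵏ, e - k from the power of μ + ab, and s from (x - a)ˢ; degree
    -- at most s + e means s + e + 1 coefficients.
    reduced-polyFn : ∀ b {k} → k < e → PolyFn (s ℕ.+ suc e) (λ a → reduced b a k)
    reduced-polyFn b = polyFn-mulLinPow b s λ {k} k<e →
      polyFn-* (binom ((e ∸ k) ℕ.+ m) k) $ polyFn-cong
        (λ a → cong₂ (λ x y → x ^ k * y) (S.solve 1 (λ a → con 0 :+ con 1 :* a := a) refl a)
                 (trans (*-identityʳ _) (cong (λ x → (μ + x) ^ (e ∸ k)) (*-comm b a)))) $
        subst (λ n → PolyFn n (λ a → (0# + 1# * a) ^ k * ((μ + b * a) ^ (e ∸ k) * 1#))) (size k<e) $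
          polyFn-linPow 0# 1# k (polyFn-linPow μ b (e ∸ k) polyFn-1)
      where
      size : ∀ {k} → k < e → k ℕ.+ ((e ∸ k) ℕ.+ 1) ≡ suc e
      size {k} k<e = trans (sym (ℕₚ.+-assoc k (e ∸ k) 1))
        (trans (cong (ℕ._+ 1) (ℕₚ.m+[n∸m]≡n (ℕₚ.<⇒≤ k<e))) (ℕₚ.+-comm e 1))

    -- Only the power of μ + ab is reduced. The binomial coefficient may keep its m, since it does
    -- not depend on a.
    factor≡reduced : ∀ {a b} → RootOrZero m (μ + a * b) → ∀ {k} → k < e →
      mulLinPow (μ + a * b) a (e ℕ.+ m) δ k ≡ reducedFactor b a k
    factor≡reduced {a} {b} rz {k} k<e = begin
      mulLinPow u a (e ℕ.+ m) δ k
        ≡⟨ cong (λ n → mulLinPow u a n δ k) split ⟩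
      mulLinPow u a ((e ∸ k) ℕ.+ m ℕ.+ k) δ k
        ≡⟨ mulLinPow-δ u a ((e ∸ k) ℕ.+ m) k ⟩
      binom ((e ∸ k) ℕ.+ m) k * (a ^ k * u ^ ((e ∸ k) ℕ.+ m))
        ≡⟨ cong (λ x → binom ((e ∸ k) ℕ.+ m) k * (a ^ k * x)) reduce ⟩
      reducedFactor b a k ∎
      where
      u = μ + a * b
      split : e ℕ.+ m ≡ (e ∸ k) ℕ.+ m ℕ.+ k
      split = begin
        e ℕ.+ m                       ≡⟨ cong (ℕ._+ m) (ℕₚ.m∸n+n≡m (ℕₚ.<⇒≤ k<e)) ⟨
        (e ∸ k) ℕ.+ k ℕ.+ m           ≡⟨ ℕₚ.+-assoc (e ∸ k) k m ⟩
        (e ∸ k) ℕ.+ (k ℕ.+ m)         ≡⟨ cong ((e ∸ k) ℕ.+_) (ℕₚ.+-comm k m) ⟩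
        (e ∸ k) ℕ.+ (m ℕ.+ k)         ≡⟨ ℕₚ.+-assoc (e ∸ k) m k ⟨
        (e ∸ k) ℕ.+ m ℕ.+ k           ∎
      reduce : u ^ ((e ∸ k) ℕ.+ m) ≡ u ^ (e ∸ k)
      reduce with e ∸ k | ℕₚ.m<n⇒0<n∸m k<e
      ... | suc j | _ = rootOrZero-^ j rz

    actual≡reduced : ∀ {a b} → RootOrZero m (μ + a * b) → ∀ {k} → k < e → actual b a k ≡ reduced b a k
    actual≡reduced rz {k} k<e =
      mulLinPow-cong _ 1# s k λ i≤k → factor≡reduced rz (ℕₚ.≤-<-trans i≤k k<e)

    actual≡reduced-low : ∀ a {k} → k < s → actual a a k ≡ reduced a a k
    actual≡reduced-low a k<s =
      trans (mulLinPow-root-low s _ (-b+1*b a) k<s) (sym (mulLinPow-root-low s _ (-b+1*b a) k<s))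

    -- At order s the factor (x - a)ˢ leaves the constant terms uᵉ and uᵉ⁺ᵐ. As u ≠ 0, their
    -- equality would force uᵐ = 1.
    reduced≢actual : ∀ {a} → ¬ RootOrZero m (μ + a * a) → reduced a a s ≢ actual a a s
    reduced≢actual {a} ¬rz eq = ¬rz (inj₁ (sym (*-cancelˡ (^-≢0 e (¬rz ∘ inj₂)) (begin
      u ^ e * 1#                     ≡⟨ S.solve 1 (λ x → x :* con 1 := con 1 :* (con 1 :* x)) refl (u ^ e) ⟩
      reducedFactor a a zero         ≡⟨ mulLinPow-root s _ (-b+1*b a) ⟨
      reduced a a s                  ≡⟨ eq ⟩
      actual a a s                   ≡⟨ mulLinPow-root s _ (-b+1*b a) ⟩
      mulLinPow u a (e ℕ.+ m) δ 0    ≡⟨ mulLinPow-at-0 u a (e ℕ.+ m) δ ⟩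
      u ^ (e ℕ.+ m) * 1#             ≡⟨ *-identityʳ _ ⟩
      u ^ (e ℕ.+ m)                  ≡⟨ ^-+ u e m ⟩
      u ^ e * u ^ m                  ∎))))
      where u = μ + a * a

    term : F → Vec F (s ℕ.+ ((e ℕ.+ m) ℕ.+ 1))
    term a = linPow (- a) 1# s (linPow μ a (e ℕ.+ m) (1# ∷ []))

    taylor-term : ∀ b a k → taylor b (term a) k ≡ actual b a k
    taylor-term b a k = trans (taylor-linPow (- a) 1# s (linPow μ a (e ℕ.+ m) (1# ∷ [])) b k)
      (mulLinPow-cong _ 1# s k λ {i} _ → trans (taylor-linPow μ a (e ℕ.+ m) (1# ∷ []) b i)
        (mulLinPow-cong _ a (e ℕ.+ m) i λ {j} _ → taylor-1 b j))

    bound : ∀ a₀ zs → Unique (a₀ ∷ zs) → suc (length zs) ≡ s ℕ.+ e ℕ.+ 2 →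
      (∀ {a b} → a ∈ a₀ ∷ zs → b ∈ a₀ ∷ zs → a ≢ b → RootOrZero m (μ + a * b)) →
      ¬ RootOrZero m (μ + a₀ * a₀) →
      suc (length zs) ℕ.* s ≤ s ℕ.+ e ℕ.+ m
    bound a₀ zs u len rz ¬rz = ℕₚ.≤-pred $ subst (suc (length zs) ℕ.* s <_) (degree s e m) $
      roots-bound s (a₀ ∷ zs) u f (a₀ , s , f≢0) vanishes
      where
      degree : ∀ s e m → s ℕ.+ ((e ℕ.+ m) ℕ.+ 1) ≡ suc (s ℕ.+ e ℕ.+ m)
      degree = solve-∀
      -- For N points the divided difference kills polynomials with N - 1 coefficients, exactly the
      -- s + e + 1 of `reduced-polyFn`.
      moments : ∀ s e → s ℕ.+ e ℕ.+ 2 ≡ suc (s ℕ.+ suc e)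
      moments = solve-∀
      open DividedDifference (dividedDifference a₀ zs u)
      f = combine weights term
      taylor-f : ∀ b k → taylor b f k ≡ wsum weights (λ a → actual b a k)
      taylor-f b k = trans (taylor-combine weights term b k) (wsum-cong λ {a} _ → taylor-term b a k)
      reduced≡0 : ∀ b {k} → k < e → wsum weights (λ a → reduced b a k) ≡ 0#
      reduced≡0 b k<e = annihilates (subst (λ n → PolyFn n _)
        (sym (ℕₚ.suc-injective (trans len (moments s e)))) (reduced-polyFn b k<e))
      vanishes : ∀ {b} → b ∈ a₀ ∷ zs → Vanishes f b s
      vanishes {b} b∈ {k} k<s = trans (taylor-f b k) (trans (wsum-cong pointwise) (reduced≡0 b k<e))
        where
        k<e = ℕₚ.<-trans k<s s<e
        pointwise : ∀ {a} → a ∈ a₀ ∷ zs → actual b a k ≡ reduced b a k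
        pointwise {a} a∈ with a ≟ b
        ... | yes refl = actual≡reduced-low a k<s
        ... | no a≢b   = actual≡reduced (rz a∈ b∈ a≢b) k<e
      difference : F → F
      difference a = - reduced a₀ a s + actual a₀ a s
      -- The reduced part is still killed at order s, and `difference` vanishes on `zs`, so only the
      -- weight at `a₀` contributes.
      taylor-f-a₀ : taylor a₀ f s ≡ leading * difference a₀
      taylor-f-a₀ = begin
        taylor a₀ f s
          ≡⟨ taylor-f a₀ s ⟩
        wsum weights (λ a → actual a₀ a s)
          ≡⟨ wsum-cong (λ {a} _ → restore (reduced a₀ a s) (actual a₀ a s)) ⟩
        wsum weights (λ a → reduced a₀ a s + difference a)
          ≡⟨ wsum-+ weights _ difference ⟩
        wsum weights (λ a → reduced a₀ a s) + wsum weights difference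
          ≡⟨ trans (cong (_+ wsum weights difference) (reduced≡0 a₀ s<e)) (+-identityˡ _) ⟩
        wsum weights difference
          ≡⟨ wsum-single difference (λ {a} a∈ → trans (cong (- reduced a₀ a s +_)
               (actual≡reduced (rz (there a∈) (here refl) (λ { refl → Unique⇒∉ u a∈ })) s<e)) (-‿inverseˡ _)) ⟩
        leading * difference a₀ ∎
        where
        restore : ∀ x y → y ≡ x + (- x + y)
        restore x y = trans (sym (+-identityˡ y))
          (trans (cong (_+ y) (sym (-‿inverseʳ x))) (+-assoc x (- x) y))
      f≢0 : taylor a₀ f s ≢ 0#
      f≢0 eq = *-≢0 leading≢0 (reduced≢actual ¬rz ∘ diff≡0⇒≡ _ _) (trans (sym taylor-f-a₀) eq)

-- Balancing s and e

parity : ∀ n → ∃[ s ] (n ≡ s ℕ.+ s ⊎ n ≡ suc (s ℕ.+ s))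
parity zero    = 0 , inj₁ refl
parity (suc n) with parity n
... | s , inj₁ refl = s , inj₂ refl
... | s , inj₂ refl = suc s , inj₁ (cong suc (sym (ℕₚ.+-suc s s)))

-- In use x is N - 4 and r is s + e; doubling the second inequality lets 2r cancel.
square-bound : ∀ {x r m} N s → x ℕ.* x ℕ.+ 2 ℕ.* r ≤ 2 ℕ.* (N ℕ.* s) →
  N ℕ.* s ≤ r ℕ.+ m → x ℕ.* x ≤ 2 ℕ.* m
square-bound {x} {r} {m} N s small h = ℕₚ.+-cancelʳ-≤ (2 ℕ.* r) _ _ $
  ℕₚ.≤-trans small $ ℕₚ.≤-trans (ℕₚ.*-monoʳ-≤ 2 h) $ ℕₚ.≤-reflexive $
    trans (ℕₚ.*-distribˡ-+ 2 r m) (ℕₚ.+-comm (2 ℕ.* r) (2 ℕ.* m))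

-- For N > 4, s and e are as close as s < e and s + e = N - 2 permit: e = s + 1 for odd N and e = s
-- + 2 for even N. For N ≤ 4 the truncated difference is 0.
optimize : ∀ N m → (∀ e s → s < e → N ≡ s ℕ.+ e ℕ.+ 2 → N ℕ.* s ≤ s ℕ.+ e ℕ.+ m) →
  (N ∸ 4) ℕ.* (N ∸ 4) ≤ 2 ℕ.* m
optimize 0 m _ = z≤n
optimize 1 m _ = z≤n
optimize 2 m _ = z≤n
optimize 3 m _ = z≤n
optimize 4 m _ = z≤n
optimize (suc (suc (suc (suc (suc k))))) m h with parity k
... | t , inj₁ refl = square-bound {1 ℕ.+ (t ℕ.+ t)} {1 ℕ.+ t ℕ.+ (2 ℕ.+ t)} (5 ℕ.+ (t ℕ.+ t)) (1 ℕ.+ t)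
    (ℕₚ.≤-trans (ℕₚ.m≤m+n _ (6 ℕ.* t ℕ.+ 3)) (ℕₚ.≤-reflexive (slack t)))
    (h (2 ℕ.+ t) (1 ℕ.+ t) ℕₚ.≤-refl (total t))
  where
  slack : ∀ t → (1 ℕ.+ (t ℕ.+ t)) ℕ.* (1 ℕ.+ (t ℕ.+ t)) ℕ.+ 2 ℕ.* (1 ℕ.+ t ℕ.+ (2 ℕ.+ t)) ℕ.+ (6 ℕ.* t ℕ.+ 3)
                ≡ 2 ℕ.* ((5 ℕ.+ (t ℕ.+ t)) ℕ.* (1 ℕ.+ t))
  slack = solve-∀
  total : ∀ t → 5 ℕ.+ (t ℕ.+ t) ≡ 1 ℕ.+ t ℕ.+ (2 ℕ.+ t) ℕ.+ 2
  total = solve-∀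
... | t , inj₂ refl = square-bound {2 ℕ.+ (t ℕ.+ t)} {1 ℕ.+ t ℕ.+ (3 ℕ.+ t)} (6 ℕ.+ (t ℕ.+ t)) (1 ℕ.+ t)
    (ℕₚ.≤-trans (ℕₚ.m≤m+n _ (4 ℕ.* t)) (ℕₚ.≤-reflexive (slack t)))
    (h (3 ℕ.+ t) (1 ℕ.+ t) (ℕₚ.n≤1+n _) (total t))
  where
  -- The slack 4t is zero at N = 6, where the estimate is an equality.
  slack : ∀ t → (2 ℕ.+ (t ℕ.+ t)) ℕ.* (2 ℕ.+ (t ℕ.+ t)) ℕ.+ 2 ℕ.* (1 ℕ.+ t ℕ.+ (3 ℕ.+ t)) ℕ.+ 4 ℕ.* t
                ≡ 2 ℕ.* ((6 ℕ.+ (t ℕ.+ t)) ℕ.* (1 ℕ.+ t))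
  slack = solve-∀
  total : ∀ t → 6 ℕ.+ (t ℕ.+ t) ≡ 1 ℕ.+ t ℕ.+ (3 ℕ.+ t) ℕ.+ 2
  total = solve-∀

-- From d-th powers to m-th roots of unity

theorem4p2 : (d q : ℕ) → 2 ≤ d → IsPrimePower q → d ∣ (q ∸ 1) →
    (K : FiniteField q) →
    let open FiniteField K in
    (A : List F) → Unique A → All (λ a → a ≢ 0#) A →
    (λ′ : F) → λ′ ≢ 0# →
    (∀ a b → a ∈ A → b ∈ A → a ≢ b → ((a * b) + λ′) ∈S[ d ]∪0) →
    (∃[ a ] ∃[ b ] (a ∈ A × b ∈ A × ¬ (((a * b) + λ′) ∈S[ d ]∪0))) →
    d ℕ.* ((length A ∸ 4) ℕ.* (length A ∸ 4)) ≤ 2 ℕ.* (q ∸ 1)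
theorem4p2 d q 2≤d _ (divides m q-1≡md) K A uA _ μ _ good (a₀ , b₀ , a₀∈ , b₀∈ , bad) =
  diagonal (a₀ ≟ b₀)
  where
  open FiniteField K
  open Field K
  open CommutativeRing commutativeRing using (+-comm)
  1≤d : 1 ≤ d
  1≤d = ℕₚ.≤-trans (s≤s z≤n) 2≤d
  diagonal : Dec (a₀ ≡ b₀) → d ℕ.* ((length A ∸ 4) ℕ.* (length A ∸ 4)) ≤ 2 ℕ.* (q ∸ 1)
  diagonal (no a₀≢b₀) = contradiction (good a₀ b₀ a₀∈ b₀∈ a₀≢b₀) bad
  -- `a₀` moves to the front to become the distinguished point of the divided difference.
  diagonal (yes refl) with zs , A↭ ← ∈-extract a₀∈ =
    subst₂ (λ n Q → d ℕ.* ((n ∸ 4) ℕ.* (n ∸ 4)) ≤ 2 ℕ.* Q) (sym (↭-length A↭)) (sym q-1≡md) $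
      ℕₚ.≤-trans (ℕₚ.*-monoʳ-≤ d (optimize (suc (length zs)) m λ e s s<e len →
        Stepanov.bound μ m e s s<e a₀ zs (Unique-resp-↭ A↭ uA) len root notRoot))
      (ℕₚ.≤-reflexive (rearrange d m))
    where
    rearrange : ∀ d m → d ℕ.* (2 ℕ.* m) ≡ 2 ℕ.* (m ℕ.* d)
    rearrange = solve-∀
    root : ∀ {a b} → a ∈ a₀ ∷ zs → b ∈ a₀ ∷ zs → a ≢ b → RootOrZero m (μ + a * b)
    root {a} {b} a∈ b∈ a≢b = subst (RootOrZero m) (+-comm (a * b) μ) $ Sum.map₁ (∈S⇒^≡1 {m = m} 1≤d q-1≡md)
      (good a b (∈-resp-↭ (↭-sym A↭) a∈) (∈-resp-↭ (↭-sym A↭) b∈) a≢b)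
    notRoot : ¬ RootOrZero m (μ + a₀ * a₀)
    -- The converse power criterion comes under a double negation, which suffices for a refutation.
    notRoot (inj₁ eq) = ^≡1⇒∈S {m = m} 1≤d q-1≡md (trans (cong (_^ m) (+-comm _ μ)) eq) (bad ∘ inj₁)
    notRoot (inj₂ eq) = bad (inj₂ (trans (+-comm _ μ) eq))
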